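{- Let $\mathcal{H}=(X,\mathcal{E})$ be a finite hypergraph with no isolated vertices and no empty hyperedge, and let $G$ be its incidence graph. Then $\gamma_{\rm gr}^t(G)=2\rho_{\rm gr}(\mathcal{H})$.
   Context: The incidence graph of $\mathcal{H}$ is the bipartite graph with vertex set $X\cup\mathcal{E}$ (disjoint copies), where $x\in X$ is adjacent to $B\in\mathcal{E}$ iff $x\in B$. A sequence $(C_1,\ldots,C_r)$ of distinct hyperedges is an edge covering sequence if $C_i\setminus\bigcup_{j<i}C_j\neq\emptyset$ for all $i\in\{2,\ldots,r\}$ and $C_1\cup\cdots\cup C_r=X$; $\rho_{\rm gr}(\mathcal{H})$ is the maximum length of an edge covering sequence. For a graph $G$ without isolated vertices, with $N(v)$ the open neighborhood, a sequence $(v_1,\ldots,v_k)$ of distinct vertices is a total dominating sequence if $N(v_i)\setminus \bigcup_{j=1}^{i-1} N(v_j)\neq\emptyset$ for every $i\in\{2,\ldots,k\}$ and every vertex of $G$ has a neighbor in $\{v_1,\ldots,v_k\}$; $\gamma_{\rm gr}^t(G)$ is the maximum length of a total dominating sequence. -}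

module Defs where

open import Data.Empty using (⊥)
open import Data.Fin using (Fin; toℕ; _<_)
open import Data.Fin.Subset using (Subset; Nonempty) renaming (_∈_ to _∈ₛ_)
open import Data.Nat using (ℕ; _≤_) renaming (_<_ to _<ℕ_)
open import Data.Nat.Properties using (≤-antisym)
open import Data.Product using (Σ-syntax; ∃-syntax; _×_; _,_; proj₁)
open import Data.Sum using (_⊎_; inj₁; inj₂)
open import Function.Definitions using (Injective)
open import Level using (0ℓ)
open import Relation.Binary.PropositionalEquality using (_≡_)
open import Relation.Nullary using (¬_)
open import Relation.Unary using (Pred; Satisfiable; Universal; _∖_; ⋃)

IsMaximum : Pred ℕ 0ℓ → Pred ℕ 0ℓ
IsMaximum P k = P k × (∀ l → P l → l ≤ k)

IsMaximum-unique : ∀ {P k l} → IsMaximum P k → IsMaximum P l → k ≡ l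
IsMaximum-unique (pk , k-max) (pl , l-max) = ≤-antisym (l-max _ pk) (k-max _ pl)

-- Sequences are indexed from 0, so 0 < toℕ i excludes exactly the first term.
module _ {A : Set} {k : ℕ} (S : Fin k → Pred A 0ℓ) where

  Earlier : Fin k → Pred A 0ℓ
  Earlier i = ⋃ (Σ[ j ∈ Fin k ] j < i) (λ j<i → S (proj₁ j<i))

  EachAddsNew : Set
  EachAddsNew = ∀ i → 0 <ℕ toℕ i → Satisfiable (S i ∖ Earlier i)

  CoversAll : Set
  CoversAll = Universal (⋃ (Fin k) S)

-- The vertex set X is Fin order and the set of hyperedges is the image of the
-- injective map edge, so hyperedges are named by their indices and there are
-- no repeated hyperedges.
record Hypergraph : Set where
  field
    order          : ℕ
    size           : ℕ
    edge           : Fin size → Subset order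
    edge-injective : Injective _≡_ _≡_ edge

module _ (H : Hypergraph) where
  open Hypergraph H

  NoIsolatedVertices : Set
  NoIsolatedVertices = ∀ x → ∃[ e ] x ∈ₛ edge e

  NoEmptyHyperedges : Set
  NoEmptyHyperedges = ∀ e → Nonempty (edge e)

  hyperedgeSet : Fin size → Pred (Fin order) 0ℓ
  hyperedgeSet e x = x ∈ₛ edge e

  record IsEdgeCoveringSequence {r : ℕ} (C : Fin r → Fin size) : Set where
    field
      distinct : Injective _≡_ _≡_ C
      addsNew  : EachAddsNew (λ i → hyperedgeSet (C i))
      covers   : CoversAll (λ i → hyperedgeSet (C i))

  -- ρ_gr(H) = r
  IsGrundyCoveringNumber : Pred ℕ 0ℓ
  IsGrundyCoveringNumber =
    IsMaximum (λ r → Σ[ C ∈ (Fin r → Fin size) ] IsEdgeCoveringSequence C)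

record Graph : Set₁ where
  field
    Vertex   : Set
    _~_      : Vertex → Vertex → Set
    ~-sym    : ∀ {u v} → u ~ v → v ~ u
    ~-irrefl : ∀ {v} → ¬ (v ~ v)

module _ (G : Graph) where
  open Graph G

  N : Vertex → Pred Vertex 0ℓ
  N v w = v ~ w

  record IsTotalDominatingSequence {k : ℕ} (v : Fin k → Vertex) : Set where
    field
      distinct  : Injective _≡_ _≡_ v
      addsNew   : EachAddsNew (λ i → N (v i))
      dominates : ∀ w → ∃[ i ] w ~ v i

  -- γ_gr^t(G) = k
  IsGrundyTotalDominationNumber : Pred ℕ 0ℓ
  IsGrundyTotalDominationNumber =
    IsMaximum (λ k → Σ[ v ∈ (Fin k → Vertex) ] IsTotalDominatingSequence v)

incidenceGraph : Hypergraph → Graph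
incidenceGraph H = record
  { Vertex   = Fin order ⊎ Fin size
  ; _~_      = _~_
  ; ~-sym    = λ {u} {v} → ~-sym u v
  ; ~-irrefl = λ {v} → ~-irrefl v
  }
  where
  open Hypergraph H

  _~_ : Fin order ⊎ Fin size → Fin order ⊎ Fin size → Set
  inj₁ x ~ inj₁ y = ⊥
  inj₁ x ~ inj₂ e = x ∈ₛ edge e
  inj₂ e ~ inj₁ x = x ∈ₛ edge e
  inj₂ e ~ inj₂ f = ⊥

  ~-sym : ∀ u v → u ~ v → v ~ u
  ~-sym (inj₁ x) (inj₂ e) x∈e = x∈e
  ~-sym (inj₂ e) (inj₁ x) x∈e = x∈e

  ~-irrefl : ∀ v → ¬ (v ~ v)
  ~-irrefl (inj₁ x) ()
  ~-irrefl (inj₂ e) ()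

{-# OPTIONS --safe #-}

-- Pair each term of a sequence with something that it is the first to cover.
-- Reversing such a list and swapping its pairs turns it into one for the
-- converse relation, so hyperedges over vertices and vertices over hyperedges
-- have the same maximal length r. A list for the incidence graph is an
-- interleaving of one of each kind, so its maximal length is 2r. When there are
-- no isolated points a list of maximal length covers everything, as otherwise it
-- could be extended; this applies to the hypergraph and to the graph alike.

module Submission where

open import Defs
open import Data.Fin using (Fin; zero; suc; _<_)
open import Data.Fin.Properties using (<-cmp; any?; injective⇒≤)
open import Data.Fin.Subset.Properties using (_∈?_)
open import Data.List using (List; []; _∷_; _++_; _∷ʳ_; length; lookup; map; mapMaybe; reverse; tabulate)
open import Data.List.Membership.Propositional.Properties using (∈-lookup)
open import Data.List.Properties using (length-++; length-map; length-reverse; length-tabulate; unfold-reverse)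
open import Data.List.Relation.Unary.All as All using (All; []; _∷_)
import Data.List.Relation.Unary.All.Properties as Allₚ
open import Data.List.Relation.Unary.AllPairs using (AllPairs; []; _∷_; allPairs?)
import Data.List.Relation.Unary.AllPairs.Properties as AllPairsₚ
open import Data.List.Relation.Unary.Any as Any using (Any)
import Data.List.Relation.Unary.Any.Properties as Anyₚ
open import Data.Maybe using (Maybe; just; nothing)
open import Data.Nat using (ℕ; zero; suc; _+_; _*_; _≤_; s≤s⁻¹; z<s)
open import Data.Nat.Properties using (≤∧≢⇒<; 1+n≰n; +-comm; +-suc; +-identityʳ; +-mono-≤; suc-injective; module ≤-Reasoning)
open import Data.Product using (Σ-syntax; ∃; ∃-syntax; _×_; _,_; proj₁; proj₂; swap; uncurry)
open import Data.Sum using (inj₁; inj₂)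
open import Function using (_∘_; flip)
open import Function.Definitions using (Injective)
open import Level using (0ℓ)
open import Relation.Binary using (Rel; REL; tri<; tri≈; tri>)
import Relation.Binary as B
open import Relation.Binary.PropositionalEquality using (_≡_; refl; sym; trans; cong; cong₂; subst)
open import Relation.Nullary using (Dec; yes; no; ¬_; ¬?; contradiction; map′; _×-dec_)
open import Relation.Unary using (Pred; Decidable; _∖_)

private variable
  A C D E : Set
  k : ℕ

-- Maxima and exhaustive search.

IsMaximum-resp : {P Q : Pred ℕ 0ℓ} → (∀ {l} → P l → Q l) → (∀ {l} → Q l → P l) →
                 IsMaximum P k → IsMaximum Q k
IsMaximum-resp to from (p , max) = to p , λ l q → max l (from q)

-- The search runs downward from the bound, so its first hit is a maximum; `P 0` guarantees a hit.
maximum : {P : Pred ℕ 0ℓ} → Decidable P → ∀ n → P 0 → (∀ l → P l → l ≤ n) → ∃ (IsMaximum P)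
maximum P? zero    p₀ bound = 0 , p₀ , bound
maximum P? (suc n) p₀ bound with P? (suc n)
... | yes p = suc n , p , bound
... | no ¬p = maximum P? n p₀ λ l p → s≤s⁻¹ (≤∧≢⇒< (bound l p) λ { refl → ¬p p })

Searchable : Set → Set₁
Searchable A = {P : Pred A 0ℓ} → Decidable P → Dec (∃ P)

Fin×Fin-searchable : ∀ {m n} → Searchable (Fin m × Fin n)
Fin×Fin-searchable P? =
  map′ (λ { (i , j , p) → (i , j) , p }) (λ { ((i , j) , p) → i , j , p })
       (any? λ i → any? λ j → P? (i , j))

-- Together with `maximum` this produces a maximal length constructively: whether a length occurs is
-- settled by searching over the head and then, recursively, the tail.
listOfLength? : Searchable A → ∀ n {P : Pred (List A) 0ℓ} → Decidable P →
                Dec (∃[ xs ] (length xs ≡ n × P xs))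
listOfLength? search zero P? =
  map′ (λ p → [] , refl , p) (λ { ([] , _ , p) → p }) (P? [])
listOfLength? search (suc n) P? =
  map′ (λ { (x , xs , eq , p) → x ∷ xs , cong suc eq , p })
       (λ { (x ∷ xs , eq , p) → x , xs , suc-injective eq , p })
       (search λ x → listOfLength? search n (P? ∘ (x ∷_)))

-- Pairwise conditions on lists.

AllPairs-lookup : {R : Rel A 0ℓ} {xs : List A} → AllPairs R xs →
                  ∀ {i j} → i < j → R (lookup xs i) (lookup xs j)
AllPairs-lookup (px ∷ _)   {zero}  {suc j} _   = All.lookup px (∈-lookup j)
AllPairs-lookup (_  ∷ pxs) {suc i} {suc j} i<j = AllPairs-lookup pxs (s≤s⁻¹ i<j)

AllPairs-reverse⁺ : {R : Rel A 0ℓ} {xs : List A} → AllPairs R xs → AllPairs (flip R) (reverse xs)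
AllPairs-reverse⁺ [] = []
AllPairs-reverse⁺ {R = R} {xs = x ∷ xs} (px ∷ pxs) =
  subst (AllPairs (flip R)) (sym (unfold-reverse x xs))
    (AllPairsₚ.++⁺ (AllPairs-reverse⁺ pxs) ([] ∷ [])
      (All.map (_∷ []) (Allₚ.anti-mono Anyₚ.reverse⁻ px)))

module _ {f : A → Maybe C} where

  All-mapMaybe⁺ : {P : Pred A 0ℓ} {Q : Pred C 0ℓ} → (∀ {x u} → f x ≡ just u → P x → Q u) →
                  ∀ {xs} → All P xs → All Q (mapMaybe f xs)
  All-mapMaybe⁺ h [] = []
  All-mapMaybe⁺ h {x ∷ _} (p ∷ ps) with f x in eq
  ... | nothing = All-mapMaybe⁺ h ps
  ... | just _  = h eq p ∷ All-mapMaybe⁺ h ps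

  AllPairs-mapMaybe⁺ : {R : Rel A 0ℓ} {S : Rel C 0ℓ} →
                       (∀ {x y u v} → f x ≡ just u → f y ≡ just v → R x y → S u v) →
                       ∀ {xs} → AllPairs R xs → AllPairs S (mapMaybe f xs)
  AllPairs-mapMaybe⁺ h [] = []
  AllPairs-mapMaybe⁺ h {x ∷ _} (p ∷ ps) with f x in eq
  ... | nothing = AllPairs-mapMaybe⁺ h ps
  ... | just _  = All-mapMaybe⁺ (h eq) p ∷ AllPairs-mapMaybe⁺ h ps

-- Footprinted lists.

Misses : REL A C 0ℓ → Rel (A × C) 0ℓ
Misses R p q = ¬ R (proj₁ p) (proj₂ q)

-- A triangular submatrix: with first components as rows and second components as columns, `R` holds
-- on the diagonal and fails above it. Covering everything is deliberately left out.
Footprinted : REL A C 0ℓ → Pred (List (A × C)) 0ℓ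
Footprinted R ps = All (uncurry R) ps × AllPairs (Misses R) ps

FootprintedLength : REL A C 0ℓ → Pred ℕ 0ℓ
FootprintedLength R k = ∃[ ps ] (length ps ≡ k × Footprinted R ps)

footprinted? : {R : REL A C 0ℓ} → B.Decidable R → Decidable (Footprinted R)
footprinted? R? ps = All.all? (λ (a , c) → R? a c) ps
               ×-dec allPairs? (λ (a , _) (_ , d) → ¬? (R? a d)) ps

-- Swapping transposes the triangular matrix, and reversing both orders brings the zeros back above
-- the diagonal.
Footprinted-converse : {R : REL A C 0ℓ} {ps : List (A × C)} → Footprinted R ps →
                       Footprinted (flip R) (reverse (map swap ps))
Footprinted-converse (on , off) =
  Allₚ.anti-mono Anyₚ.reverse⁻ (Allₚ.map⁺ on) ,
  AllPairs-reverse⁺ (AllPairsₚ.map⁺ off)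

FootprintedLength-converse : {R : REL A C 0ℓ} → FootprintedLength R k → FootprintedLength (flip R) k
FootprintedLength-converse (ps , eq , fp) =
  reverse (map swap ps) ,
  trans (length-reverse (map swap ps)) (trans (length-map swap ps) eq) ,
  Footprinted-converse fp

-- The hypothesis involves two kept pairs because `Misses` does; the diagonal condition is the case
-- where they coincide.
Footprinted-mapMaybe : {R : REL A C 0ℓ} {S : REL D E 0ℓ} {f : A × C → Maybe (D × E)} →
  (∀ {p q u v} → f p ≡ just u → f q ≡ just v →
     R (proj₁ p) (proj₂ q) ≡ S (proj₁ u) (proj₂ v)) →
  ∀ {ps} → Footprinted R ps → Footprinted S (mapMaybe f ps)
Footprinted-mapMaybe h (on , off) =
  All-mapMaybe⁺ (λ eq r → subst (λ X → X) (h eq eq) r) on ,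
  AllPairs-mapMaybe⁺ (λ eq eq′ ¬r → subst ¬_ (h eq eq′) ¬r) off

-- If terms at positions `i < j` had equal first components, the earlier one would cover the point
-- paired with the later one, against `Misses`.
lookup-injective : {R : REL A C 0ℓ} {ps : List (A × C)} → Footprinted R ps →
                   Injective _≡_ _≡_ (proj₁ ∘ lookup ps)
lookup-injective {R = R} {ps} (on , off) {i} {j} eq with <-cmp i j
... | tri≈ _ i≡j _ = i≡j
... | tri< i<j _ _ = contradiction (subst (λ a → R a _) (sym eq) (All.lookup on (∈-lookup j)))
                                   (AllPairs-lookup off i<j)
... | tri> _ _ j<i = contradiction (subst (λ a → R a _) eq (All.lookup on (∈-lookup i)))
                                   (AllPairs-lookup off j<i)

maximumFootprintedLength : ∀ {m n} {R : REL (Fin m) (Fin n) 0ℓ} → B.Decidable R →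
                           ∃ (IsMaximum (FootprintedLength R))
maximumFootprintedLength {m} R? =
  maximum (λ k → listOfLength? Fin×Fin-searchable k (footprinted? R?)) m
          ([] , refl , [] , [])
          -- First components are distinct elements of `Fin m`, hence the bound `m`.
          (λ { _ (_ , refl , fp) → injective⇒≤ (lookup-injective fp) })

-- Covering sequences and maximality.

CoveringSequence : REL A C 0ℓ → (Fin k → A) → Set
CoveringSequence R f = Injective _≡_ _≡_ f × EachAddsNew (R ∘ f) × CoversAll (R ∘ f)

module _ {R : REL A C 0ℓ} (R? : B.Decidable R)
         (totalˡ : ∀ a → ∃[ c ] R a c) (totalʳ : ∀ c → ∃[ a ] R a c) where

  -- `EachAddsNew` is silent about the first term. There `totalˡ` supplies a point, and no earlier
  -- term exists to contain it.
  footprint : {f : Fin k → A} → EachAddsNew (R ∘ f) →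
              ∀ i → ∃ (R (f i) ∖ Earlier (R ∘ f) i)
  footprint {f = f} new zero    = let c , r = totalˡ (f zero) in c , r , λ { ((_ , ()) , _) }
  footprint         new (suc i) = new (suc i) z<s

  covering⇒footprinted : {f : Fin k → A} → CoveringSequence R f → FootprintedLength R k
  covering⇒footprinted {k = k} {f} (_ , new , _) =
    tabulate ps , length-tabulate ps ,
    Allₚ.tabulate⁺ (proj₁ ∘ proj₂ ∘ footprint new) ,
    AllPairsₚ.tabulate⁺-< (λ {i} {j} i<j r → proj₂ (proj₂ (footprint new j)) ((i , i<j) , r))
    where
    ps : Fin k → A × C
    ps i = f i , proj₁ (footprint new i)

  -- An uncovered `c` is missed by every term, which is just what appending it requires; `totalʳ`
  -- supplies its partner `a`.
  maximal-covers : ∀ {ps} → Footprinted R ps → (∀ l → FootprintedLength R l → l ≤ length ps) →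
                   CoversAll (R ∘ proj₁ ∘ lookup ps)
  maximal-covers {ps} (on , off) max c with Any.any? (λ p → R? (proj₁ p) c) ps
  ... | yes covered = Any.index covered , Anyₚ.lookup-index covered
  ... | no ¬covered = contradiction (max (suc (length ps)) (ps ∷ʳ (a , c) , longer , extended)) 1+n≰n
    where
    a = proj₁ (totalʳ c)
    longer : length (ps ∷ʳ (a , c)) ≡ suc (length ps)
    longer = trans (length-++ ps) (+-comm (length ps) 1)
    extended : Footprinted R (ps ∷ʳ (a , c))
    extended = Allₚ.∷ʳ⁺ on (proj₂ (totalʳ c)) ,
               AllPairsₚ.++⁺ off ([] ∷ []) (All.map (_∷ []) (Allₚ.¬Any⇒All¬ ps ¬covered))

  -- For the upper bound covering can be forgotten, as each covering sequence yields a footprinted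
  -- list of its length; for attainment it is recovered from maximality.
  maximal-covering : IsMaximum (FootprintedLength R) k →
                     IsMaximum (λ l → Σ[ f ∈ (Fin l → A) ] CoveringSequence R f) k
  maximal-covering ((ps , refl , fp@(on , off)) , max) =
    ( proj₁ ∘ lookup ps
    , lookup-injective fp
    , (λ i _ → proj₂ (lookup ps i) , All.lookup on (∈-lookup i) ,
               λ { ((j , j<i) , r) → AllPairs-lookup off j<i r })
    , maximal-covers fp max ) ,
    λ l (_ , covering) → max l (covering⇒footprinted covering)

-- The incidence graph.

module _ (H : Hypergraph) where
  open Hypergraph H
  open Graph (incidenceGraph H)

  private
    R : REL (Fin size) (Fin order) 0ℓ
    R = hyperedgeSet H

  hyperedgeSet? : B.Decidable R
  hyperedgeSet? e x = x ∈? edge e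

  adjacent? : B.Decidable _~_
  adjacent? (inj₁ x) (inj₁ y) = no λ ()
  adjacent? (inj₁ x) (inj₂ e) = x ∈? edge e
  adjacent? (inj₂ e) (inj₁ x) = x ∈? edge e
  adjacent? (inj₂ e) (inj₂ f) = no λ ()

  fromHyperedge : Vertex × Vertex → Maybe (Fin size × Fin order)
  fromHyperedge (inj₂ e , inj₁ x) = just (e , x)
  fromHyperedge _                 = nothing

  fromVertex : Vertex × Vertex → Maybe (Fin order × Fin size)
  fromVertex (inj₁ x , inj₂ e) = just (x , e)
  fromVertex _                 = nothing

  fromHyperedge-adjacent : ∀ {p q u v} → fromHyperedge p ≡ just u → fromHyperedge q ≡ just v →
                           proj₁ p ~ proj₂ q ≡ R (proj₁ u) (proj₂ v)
  fromHyperedge-adjacent {inj₂ _ , inj₁ _} {inj₂ _ , inj₁ _} refl refl = refl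

  fromVertex-adjacent : ∀ {p q u v} → fromVertex p ≡ just u → fromVertex q ≡ just v →
                        proj₁ p ~ proj₂ q ≡ flip R (proj₁ u) (proj₂ v)
  fromVertex-adjacent {inj₁ _ , inj₂ _} {inj₁ _ , inj₂ _} refl refl = refl

  -- Adjacency crosses the bipartition, so each pair is kept by exactly one of the two filters.
  length-parts : ∀ {ps} → All (uncurry _~_) ps →
                 length ps ≡ length (mapMaybe fromHyperedge ps) + length (mapMaybe fromVertex ps)
  length-parts [] = refl
  length-parts {(inj₂ _ , inj₁ _) ∷ _} (_ ∷ on) = cong suc (length-parts on)
  length-parts {(inj₁ _ , inj₂ _) ∷ _} (_ ∷ on) = trans (cong suc (length-parts on)) (sym (+-suc _ _))

  graphFootprinted-≤ : (∀ l → FootprintedLength R l → l ≤ k) →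
                       ∀ l → FootprintedLength _~_ l → l ≤ 2 * k
  graphFootprinted-≤ {k} max _ (ps , refl , fp) = begin
    length ps                                                            ≡⟨ length-parts (proj₁ fp) ⟩
    length (mapMaybe fromHyperedge ps) + length (mapMaybe fromVertex ps) ≤⟨ +-mono-≤ hyperedges vertices ⟩
    k + k                                                                ≡⟨ cong (k +_) (+-identityʳ k) ⟨
    2 * k                                                                ∎
    where
    open ≤-Reasoning
    hyperedges : length (mapMaybe fromHyperedge ps) ≤ k
    hyperedges = max _ (_ , refl , Footprinted-mapMaybe fromHyperedge-adjacent fp)
    vertices : length (mapMaybe fromVertex ps) ≤ k
    -- This part is footprinted for `flip R`; the converse makes `max` applicable.
    vertices = max _ (FootprintedLength-converse (_ , refl , Footprinted-mapMaybe fromVertex-adjacent fp))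

  graphFootprinted-2* : FootprintedLength R k → FootprintedLength _~_ (2 * k)
  graphFootprinted-2* {k} fpl@(ps , eq , on , off) with FootprintedLength-converse fpl
  ... | qs , eq′ , on′ , off′ =
    map hv ps ++ map vh qs ,
    trans (length-++ (map hv ps))
      (cong₂ _+_ (trans (length-map hv ps) eq)
                 (trans (length-map vh qs) (trans eq′ (sym (+-identityʳ k))))) ,
    Allₚ.++⁺ (Allₚ.map⁺ on) (Allₚ.map⁺ on′) ,
    AllPairsₚ.++⁺ (AllPairsₚ.map⁺ off) (AllPairsₚ.map⁺ off′)
      -- Across the two blocks, a pair from `hv` begins with a hyperedge and one from `vh` ends with
      -- a hyperedge, and hyperedges are never adjacent.
      (Allₚ.map⁺ (All.universal (λ _ → Allₚ.map⁺ (All.universal (λ _ ()) qs)) ps))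
    where
    hv : Fin size × Fin order → Vertex × Vertex
    hv (e , x) = inj₂ e , inj₁ x
    vh : Fin order × Fin size → Vertex × Vertex
    vh (x , e) = inj₁ x , inj₂ e

  module _ (noIsolated : NoIsolatedVertices H) (noEmpty : NoEmptyHyperedges H) where

    neighbour : ∀ v → ∃[ w ] v ~ w
    neighbour (inj₁ x) = let e , x∈e = noIsolated x in inj₂ e , x∈e
    neighbour (inj₂ e) = let x , x∈e = noEmpty e in inj₁ x , x∈e

    coveringNumber : IsMaximum (FootprintedLength R) k → IsGrundyCoveringNumber H k
    coveringNumber =
      IsMaximum-resp
        (λ (C , inj , new , cov) → C , record { distinct = inj ; addsNew = new ; covers = cov })
        (λ (C , s) → C , distinct s , addsNew s , covers s)
      -- Hyperedges stand on the left of `R`, so left totality is `noEmpty` and right totality is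
      -- `noIsolated`.
      ∘ maximal-covering hyperedgeSet? noEmpty noIsolated
      where open IsEdgeCoveringSequence

    totalDominationNumber : IsMaximum (FootprintedLength _~_) k →
                            IsGrundyTotalDominationNumber (incidenceGraph H) k
    totalDominationNumber =
      IsMaximum-resp
        (λ (v , inj , new , cov) → v , record
          { distinct = inj ; addsNew = new
          -- Domination is read from the dominated vertex, covering from the dominating one.
          ; dominates = λ w → let i , vᵢ~w = cov w in i , ~-sym {v i} {w} vᵢ~w })
        (λ (v , s) → v , distinct s , addsNew s ,
          λ w → let i , w~vᵢ = dominates s w in i , ~-sym {w} {v i} w~vᵢ)
      ∘ maximal-covering adjacent? neighbour
          (λ w → let v , w~v = neighbour w in v , ~-sym {w} {v} w~v)
      where open IsTotalDominatingSequence

mainTheorem19 : (H : Hypergraph) →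
    NoIsolatedVertices H →
    NoEmptyHyperedges H →
    ∃[ g ] ∃[ r ]
    IsGrundyTotalDominationNumber (incidenceGraph H) g ×
    IsGrundyCoveringNumber H r ×
    g ≡ 2 * r
mainTheorem19 H noIsolated noEmpty with maximumFootprintedLength (hyperedgeSet? H)
... | r , max@(fpl , bound) =
  2 * r , r ,
  -- The concatenation attains `2 * r`, and splitting into two parts bounds every length by it.
  totalDominationNumber H noIsolated noEmpty (graphFootprinted-2* H fpl , graphFootprinted-≤ H bound) ,
  coveringNumber H noIsolated noEmpty max ,
  refl
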